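{- Let $c>0$. There is a constant $C$ (depending on $c$) such that every $n$-vertex circle graph $G$ with $\alpha(G)=cn$ satisfies $h(G)\le C\sqrt{n}$.
   Context: A circle graph is a graph whose vertices are a finite set of chords of a circle, two vertices being adjacent iff the corresponding chords cross. $\alpha(G)$ is the independence number. A hitting set of $G$ is a set $T\subseteq V(G)$ meeting every maximum independent set of $G$; $h(G)$ is the minimum size of a hitting set. -}

module Defs where

open import Data.Nat using (ℕ; _<_; _≤_)
open import Data.Fin using (Fin)
open import Data.Fin.Subset using (Subset; _∈_; ∣_∣; _∩_; Nonempty)
open import Data.Product using (_×_; _,_; Σ; ∃)
open import Data.Sum using (_⊎_)
open import Relation.Binary.PropositionalEquality using (_≡_)
open import Relation.Nullary using (¬_)

-- A chord of a circle. Finitely many points on a circle are, after cutting the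
-- circle at a point that is not an endpoint, linearly ordered; we label them by
-- natural numbers in that order. A chord is a pair of distinct endpoints
-- (left endpoint strictly smaller than right endpoint).
record Chord : Set where
  constructor chord
  field
    left  : ℕ
    right : ℕ
    left<right : left < right
open Chord public

Cross : Chord → Chord → Set
Cross c d = (left c < left d × left d < right c × right c < right d)
          ⊎ (left d < left c × left c < right d × right d < right c)

record CircleGraph (n : ℕ) : Set where
  field
    chords   : Fin n → Chord
    distinct : ∀ i j → left (chords i) ≡ left (chords j)
                     → right (chords i) ≡ right (chords j) → i ≡ j
open CircleGraph public

Adj : ∀ {n} → CircleGraph n → Fin n → Fin n → Set
Adj G i j = Cross (chords G i) (chords G j)

Independent : ∀ {n} → CircleGraph n → Subset n → Set
Independent G S = ∀ i j → i ∈ S → j ∈ S → ¬ Adj G i j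

MaximumIndependent : ∀ {n} → CircleGraph n → Subset n → Set
MaximumIndependent G S =
  Independent G S × (∀ S′ → Independent G S′ → ∣ S′ ∣ ≤ ∣ S ∣)

IndependenceNumber : ∀ {n} → CircleGraph n → ℕ → Set
IndependenceNumber G k = Σ (Subset _) λ S → MaximumIndependent G S × ∣ S ∣ ≡ k

HittingSet : ∀ {n} → CircleGraph n → Subset n → Set
HittingSet G T = ∀ S → MaximumIndependent G S → Nonempty (T ∩ S)

{-# OPTIONS --safe #-}
module Submission where

-- If a chord has few neighbours, its closed neighbourhood is a small hitting set, because a
-- maximum independent set avoiding it could be enlarged.  Otherwise every chord has degree
-- of order √n, so the circle can be cut into O(√n) arcs none of which contains a chord.
-- Group the chords into classes by the arcs of their two endpoints: within a class,
-- non-crossing means nested, and an independent set meets only O(√n) classes.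
--
-- Fix a maximum independent set γ.  If S is another one and z, z′ ∈ S ∩ γ lie in one class, S
-- and γ may be exchanged between z and z′.  So the depth of a chord in the nested chain of its
-- class, measured in maximum independent sets that agree with γ off that class, is well
-- defined.  Let w be of order √n, and let T consist of the chords whose depth lies in one fixed
-- residue class mod w; for a suitable residue |T| ≤ n / w.  If S ∩ γ has at least w elements
-- in a class, S takes all depths in an interval of length w there, and meets T.  Hence a
-- maximum independent set S missing T has |S ∩ γ| = O(√n) · w, a small fraction of n.
--
-- Repeat with a missed S as the next γ.  Each round adds at least α / 2 new chords to the
-- union of the sets γ, so with α ≥ n / q at most 2q rounds are needed.

open import Defs
open import Data.Empty using (⊥; ⊥-elim)
open import Data.Fin using (Fin; zero; suc; toℕ; fromℕ<) renaming (_≟_ to _≟ᶠ_)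
import Data.Fin.Properties as Finₚ
open import Data.Fin.Properties using (toℕ-injective; toℕ-fromℕ<; toℕ<n; any?; all?)
open import Data.Fin.Subset using (Subset; ∣_∣; _∈_; _∉_; inside; outside; ⊤; _∪_) renaming (_∩_ to _⊓ˢ_)
open import Data.Fin.Subset.Properties using (_∈?_; anySubset?; nonempty?; x∈p∩q⁺; x∈p∪q⁺; x∈p∪q⁻; drop-there; ∈⊤; ∣⊤∣≡n; ∣p∣≤n)
open import Data.Integer using (+_; +[1+_]; -[1+_])
import Data.Integer as ℤ
import Data.Integer.Properties as ℤₚ
open import Data.Nat using (ℕ; zero; suc; _+_; _*_; _∸_; _≤_; _<_; _≤?_; _<?_; z≤n; s≤s; NonZero; >-nonZero⁻¹; _%_)
import Data.Nat as ℕ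
open import Data.Nat.Coprimality using (Coprime)
open import Data.Nat.DivMod using (m≡m%n+[m/n]*n; [m+kn]%n≡m%n; m<n⇒m%n≡m; m%n≤n)
open import Data.Nat.Properties
open import Algebra.Properties.CommutativeMonoid.Sum +-0-commutativeMonoid using (sum; ∑-distrib-+)
open import Algebra.Properties.CommutativeSemigroup +-commutativeSemigroup using (interchange)
open import Data.Nat.Solver using (module +-*-Solver)
open import Data.Product using (Σ; ∃; _×_; _,_; proj₁; proj₂)
open import Data.Rational using (ℚ; mkℚ; _/_; 0ℚ)
import Data.Rational as Rat
import Data.Rational.Properties as ℚₚ
import Data.Rational.Unnormalised as ℚᵘ
import Data.Rational.Unnormalised.Properties as ℚᵘₚ
open import Data.Sum using (_⊎_; inj₁; inj₂; [_,_]′)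
open import Data.Unit using (tt) renaming (⊤ to ⊤₁)
open import Data.Vec using (tabulate; []; _∷_; here; there)
open import Function using (_∘_; id)
open import Relation.Binary.Definitions using (tri<; tri≈; tri>)
open import Relation.Binary.PropositionalEquality using (_≡_; refl; sym; trans; cong; cong₂; subst; subst₂)
open import Relation.Nullary using (¬_; Dec; yes; no; does; contradiction)
open import Relation.Nullary.Decidable using (_×-dec_; _⊎-dec_; _→-dec_; ¬?; map′)

-- Indicators and counting over finite index sets.

χ : {A : Set} → Dec A → ℕ
χ (yes _) = 1
χ (no _)  = 0

χ-yes : {A : Set} (a? : Dec A) → A → χ a? ≡ 1
χ-yes (yes _) _ = refl
χ-yes (no ¬a) a = contradiction a ¬a

χ-no : {A : Set} (a? : Dec A) → ¬ A → χ a? ≡ 0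
χ-no (yes a) ¬a = contradiction a ¬a
χ-no (no _)  _  = refl

χ-cover : {A B C : Set} (a? : Dec A) (b? : Dec B) (c? : Dec C) → (A → B ⊎ C) → χ a? ≤ χ b? + χ c?
χ-cover (no _)  b? c? f = z≤n
χ-cover (yes a) b? c? f with f a
... | inj₁ b = ≤-trans (≤-reflexive (sym (χ-yes b? b))) (m≤m+n _ _)
... | inj₂ c = ≤-trans (≤-reflexive (sym (χ-yes c? c))) (m≤n+m _ (χ b?))

χ-disjoint : {A B C : Set} (a? : Dec A) (b? : Dec B) (c? : Dec C) →
             (B → A) → (C → A) → (B → C → ⊥) → χ b? + χ c? ≤ χ a?
χ-disjoint a? (yes b) (yes c) f g h = ⊥-elim (h b c)
χ-disjoint a? (yes b) (no _)  f g h = ≤-reflexive (sym (χ-yes a? (f b)))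
χ-disjoint a? (no _)  (yes c) f g h = ≤-reflexive (sym (χ-yes a? (g c)))
χ-disjoint a? (no _)  (no _)  f g h = z≤n

count : ∀ {n} {P : Fin n → Set} → (∀ i → Dec (P i)) → ℕ
count {zero}  P? = 0
count {suc n} P? = χ (P? zero) + count (P? ∘ suc)

count-cover : ∀ {n} {P Q R : Fin n → Set} (P? : ∀ i → Dec (P i)) (Q? : ∀ i → Dec (Q i)) (R? : ∀ i → Dec (R i)) →
              (∀ i → P i → Q i ⊎ R i) → count P? ≤ count Q? + count R?
count-cover {zero}  P? Q? R? f = z≤n
count-cover {suc n} P? Q? R? f = ≤-trans
  (+-mono-≤ (χ-cover (P? zero) (Q? zero) (R? zero) (f zero))
            (count-cover (P? ∘ suc) (Q? ∘ suc) (R? ∘ suc) (f ∘ suc)))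
  (≤-reflexive (interchange (χ (Q? zero)) (χ (R? zero)) (count (Q? ∘ suc)) (count (R? ∘ suc))))

count-disjoint : ∀ {n} {P Q R : Fin n → Set} (P? : ∀ i → Dec (P i)) (Q? : ∀ i → Dec (Q i)) (R? : ∀ i → Dec (R i)) →
                 (∀ i → Q i → P i) → (∀ i → R i → P i) → (∀ i → Q i → R i → ⊥) →
                 count Q? + count R? ≤ count P?
count-disjoint {zero}  P? Q? R? f g h = z≤n
count-disjoint {suc n} P? Q? R? f g h = ≤-trans
  (≤-reflexive (interchange (χ (Q? zero)) (count (Q? ∘ suc)) (χ (R? zero)) (count (R? ∘ suc))))
  (+-mono-≤ (χ-disjoint (P? zero) (Q? zero) (R? zero) (f zero) (g zero) (h zero))
            (count-disjoint (P? ∘ suc) (Q? ∘ suc) (R? ∘ suc) (f ∘ suc) (g ∘ suc) (h ∘ suc)))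

count-none : ∀ {n} {P : Fin n → Set} (P? : ∀ i → Dec (P i)) → (∀ i → ¬ P i) → count P? ≡ 0
count-none {zero}  P? f = refl
count-none {suc n} P? f = cong₂ _+_ (χ-no (P? zero) (f zero)) (count-none (P? ∘ suc) (f ∘ suc))

count-mono : ∀ {n} {P Q : Fin n → Set} (P? : ∀ i → Dec (P i)) (Q? : ∀ i → Dec (Q i)) →
             (∀ i → P i → Q i) → count P? ≤ count Q?
count-mono {n} P? Q? f = ≤-trans (count-cover P? Q? none? (λ i → inj₁ ∘ f i))
  (≤-reflexive (trans (cong (λ z → count Q? + z) (count-none none? (λ _ → id))) (+-identityʳ _)))
  where
  none? : (i : Fin n) → Dec ⊥
  none? _ = no id

count-cong : ∀ {n} {P Q : Fin n → Set} (P? : ∀ i → Dec (P i)) (Q? : ∀ i → Dec (Q i)) →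
             (∀ i → P i → Q i) → (∀ i → Q i → P i) → count P? ≡ count Q?
count-cong P? Q? f g = ≤-antisym (count-mono P? Q? f) (count-mono Q? P? g)

count≤n : ∀ {n} {P : Fin n → Set} (P? : ∀ i → Dec (P i)) → count P? ≤ n
count≤n {zero}  P? = z≤n
count≤n {suc n} P? with P? zero
... | yes _ = s≤s (count≤n (P? ∘ suc))
... | no _  = m≤n⇒m≤1+n (count≤n (P? ∘ suc))

count-singleton : ∀ {n} (x : Fin n) → count (_≟ᶠ x) ≡ 1
count-singleton {suc n} zero    = cong suc (count-none {n} (λ i → suc i ≟ᶠ zero) (λ _ ()))
count-singleton         (suc x) = trans
  (count-cong (λ i → suc i ≟ᶠ suc x) (_≟ᶠ x) (λ { _ refl → refl }) (λ { _ refl → refl })) (count-singleton x)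

count-remove : ∀ {n} {P : Fin n → Set} (P? : ∀ i → Dec (P i)) (x : Fin n) → P x →
               count P? ≡ suc (count (λ i → P? i ×-dec ¬? (i ≟ᶠ x)))
count-remove P? x px = ≤-antisym
  (≤-trans (count-cover P? (_≟ᶠ x) R? split) (≤-reflexive (cong (_+ count R?) (count-singleton x))))
  (≤-trans (≤-reflexive (cong (_+ count R?) (sym (count-singleton x))))
           (count-disjoint P? (_≟ᶠ x) R? (λ { _ refl → px }) (λ _ → proj₁) (λ _ e r → proj₂ r e)))
  where
  R? = λ i → P? i ×-dec ¬? (i ≟ᶠ x)
  split : ∀ i → _ → i ≡ x ⊎ _
  split i p with i ≟ᶠ x
  ... | yes e = inj₁ e
  ... | no ne = inj₂ (p , ne)

count-positive : ∀ {n} {P : Fin n → Set} (P? : ∀ i → Dec (P i)) → 0 < count P? → ∃ P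
count-positive P? 0<# with any? P?
... | yes e = e
... | no ¬e = ⊥-elim (<-irrefl refl (≤-trans 0<# (≤-reflexive (count-none P? (λ i p → ¬e (i , p))))))

∑-cover : ∀ k {n} {Q : Fin n → Set} {P : Fin k → Fin n → Set}
          (Q? : ∀ i → Dec (Q i)) (P? : ∀ j i → Dec (P j i)) →
          (∀ i → Q i → ∃ λ j → P j i) → count Q? ≤ sum (λ j → count (P? j))
∑-cover zero    Q? P? f = ≤-reflexive (count-none Q? λ i q → case0 (f i q))
  where
  case0 : ∀ {A : Fin 0 → Set} → ¬ ∃ A
  case0 (() , _)
∑-cover (suc k) {P = P} Q? P? f = ≤-trans (count-cover Q? (P? zero) R? split)
  (+-monoʳ-≤ (count (P? zero)) (∑-cover k R? (P? ∘ suc) rest))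
  where
  R? = λ i → Q? i ×-dec ¬? (P? zero i)
  split : ∀ i → _ → P zero i ⊎ _
  split i q with P? zero i
  ... | yes p = inj₁ p
  ... | no ¬p = inj₂ (q , ¬p)
  rest : ∀ i → _ → ∃ λ j → P (suc j) i
  rest i (q , ¬p) with f i q
  ... | zero , p  = contradiction p ¬p
  ... | suc j , p = j , p

∑-disjoint : ∀ k {n} {Q : Fin n → Set} {P : Fin k → Fin n → Set}
             (Q? : ∀ i → Dec (Q i)) (P? : ∀ j i → Dec (P j i)) →
             (∀ j i → P j i → Q i) → (∀ j j′ i → P j i → P j′ i → j ≡ j′) →
             sum (λ j → count (P? j)) ≤ count Q?
∑-disjoint zero    Q? P? f d = z≤n
∑-disjoint (suc k) Q? P? f d = ≤-trans
  (+-monoʳ-≤ (count (P? zero))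
    (∑-disjoint k R? (P? ∘ suc) (λ j i p → f (suc j) i p , λ p₀ → Finₚ.0≢1+n (d zero (suc j) i p₀ p))
      (λ j j′ i p p′ → Finₚ.suc-injective (d (suc j) (suc j′) i p p′))))
  (count-disjoint Q? (P? zero) R? (f zero) (λ _ → proj₁) (λ _ p r → proj₂ r p))
  where
  R? = λ i → Q? i ×-dec ¬? (P? zero i)

∑-≤ : ∀ k {b} (f : Fin k → ℕ) → (∀ j → f j ≤ b) → sum f ≤ k * b
∑-≤ zero    f h = z≤n
∑-≤ (suc k) f h = +-mono-≤ (h zero) (∑-≤ k (f ∘ suc) (h ∘ suc))

∑-≥ : ∀ k {b} (f : Fin k → ℕ) → (∀ j → b ≤ f j) → k * b ≤ sum f
∑-≥ zero    f h = z≤n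
∑-≥ (suc k) f h = +-mono-≤ (h zero) (∑-≥ k (f ∘ suc) (h ∘ suc))

-- Subsets as decidable predicates.

∣_∣≡count : ∀ {n} (S : Subset n) → ∣ S ∣ ≡ count (_∈? S)
∣ [] ∣≡count          = refl
∣ inside ∷ S ∣≡count  = cong suc (trans ∣ S ∣≡count
  (count-cong (_∈? S) (λ i → suc i ∈? (inside ∷ S)) (λ _ → there) (λ _ → drop-there)))
∣ outside ∷ S ∣≡count = trans ∣ S ∣≡count
  (count-cong (_∈? S) (λ i → suc i ∈? (outside ∷ S)) (λ _ → there) (λ _ → drop-there))

subset : ∀ {n} {P : Fin n → Set} → (∀ i → Dec (P i)) → Subset n
subset P? = tabulate (does ∘ P?)

∈-subset⁺ : ∀ {n} {P : Fin n → Set} (P? : ∀ i → Dec (P i)) i → P i → i ∈ subset P?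
∈-subset⁺ P? zero p with P? zero
... | yes _ = here
... | no ¬p = contradiction p ¬p
∈-subset⁺ P? (suc i) p = there (∈-subset⁺ (P? ∘ suc) i p)

∈-subset⁻ : ∀ {n} {P : Fin n → Set} (P? : ∀ i → Dec (P i)) i → i ∈ subset P? → P i
∈-subset⁻ P? zero m with P? zero | m
... | yes p | _  = p
... | no _  | ()
∈-subset⁻ P? (suc i) m = ∈-subset⁻ (P? ∘ suc) i (drop-there m)

∣subset∣ : ∀ {n} {P : Fin n → Set} (P? : ∀ i → Dec (P i)) → ∣ subset P? ∣ ≡ count P?
∣subset∣ P? = trans ∣ subset P? ∣≡count
  (count-cong (_∈? subset P?) P? (∈-subset⁻ P?) (∈-subset⁺ P?))

-- Extremal elements and ranks.

argmin : ∀ {n} {P : Fin n → Set} (P? : ∀ i → Dec (P i)) (μ : Fin n → ℕ) → ∃ P →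
         ∃ λ x → P x × (∀ y → P y → μ x ≤ μ y)
argmin P? μ (x₀ , p₀) = descend (μ x₀) x₀ p₀ ≤-refl
  where
  descend : ∀ b x → _ → μ x ≤ b → ∃ λ x → _ × (∀ y → _ → μ x ≤ μ y)
  descend b x p μx≤b with any? (λ y → P? y ×-dec (μ y <? μ x))
  descend b       x p μx≤b | no ¬smaller = x , p , λ y q → ≮⇒≥ (λ lt → ¬smaller (y , q , lt))
  descend zero    x p μx≤b | yes (y , q , lt) = ⊥-elim (n≮0 (≤-trans lt μx≤b))
  descend (suc b) x p μx≤b | yes (y , q , lt) = descend b y q (≤-pred (≤-trans lt μx≤b))

-- The recursion is on the number of indices with a larger value of `μ`: moving to a larger `y`
-- drops at least `y` itself from that number.
argmax : ∀ {n} {P : Fin n → Set} (P? : ∀ i → Dec (P i)) (μ : Fin n → ℕ) → ∃ P →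
         ∃ λ x → P x × (∀ y → P y → μ y ≤ μ x)
argmax {n} {P} P? μ (x₀ , p₀) = ascend n x₀ p₀ (≤-trans (count≤n (λ y → μ x₀ <? μ y)) ≤-refl)
  where
  ascend : ∀ b x → P x → count (λ y → μ x <? μ y) ≤ b → ∃ λ x → P x × (∀ y → P y → μ y ≤ μ x)
  ascend b x p #≤b with any? (λ y → P? y ×-dec (μ x <? μ y))
  ascend b x p #≤b | no ¬greater = x , p , λ y q → ≮⇒≥ (λ lt → ¬greater (y , q , lt))
  ascend b x p #≤b | yes (y , q , lt) with b | ≤-trans (≤-reflexive (sym (count-remove (λ z → μ x <? μ z) y lt))) #≤b
  ... | suc b′ | s≤s #≤b′ = ascend b′ y q (≤-trans
          (count-mono (λ z → μ y <? μ z) (λ z → (μ x <? μ z) ×-dec ¬? (z ≟ᶠ y))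
            (λ z lt′ → <-trans lt lt′ , λ { refl → <-irrefl refl lt′ })) #≤b′)

-- As `μ` is injective on `Y`, the ranks run through all of 0, 1, ... without gaps. Rank `suc t` in
-- `Y` is rank `t` once the maximum is removed.
rank-exists : ∀ t {n} {Y : Fin n → Set} (Y? : ∀ i → Dec (Y i)) (μ : Fin n → ℕ) →
              (∀ x y → Y x → Y y → μ x ≡ μ y → x ≡ y) → t < count Y? →
              ∃ λ u → Y u × count (λ v → Y? v ×-dec (μ u <? μ v)) ≡ t
rank-exists t Y? μ inj t<#Y with argmax Y? μ (count-positive Y? (≤-trans (s≤s z≤n) t<#Y))
rank-exists zero    Y? μ inj t<#Y | top , ytop , max =
  top , ytop , count-none (λ v → Y? v ×-dec (μ top <? μ v)) (λ v (y , lt) → <⇒≱ lt (max v y))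
rank-exists (suc t) Y? μ inj t<#Y | top , ytop , max
  with rank-exists t (λ i → Y? i ×-dec ¬? (i ≟ᶠ top)) μ (λ x y (yx , _) (yy , _) → inj x y yx yy)
         (≤-pred (≤-trans t<#Y (≤-reflexive (count-remove Y? top ytop))))
... | u , (yu , u≢top) , rank-u = u , yu , trans
  (count-remove (λ v → Y? v ×-dec (μ u <? μ v)) top
    (ytop , ≤∧≢⇒< (max u yu) (u≢top ∘ inj u top yu ytop)))
  (cong suc (trans (count-cong (λ i → (Y? i ×-dec (μ u <? μ i)) ×-dec ¬? (i ≟ᶠ top))
                               (λ i → (Y? i ×-dec ¬? (i ≟ᶠ top)) ×-dec (μ u <? μ i))
    (λ _ ((a , b) , c) → (a , c) , b) (λ _ ((a , c) , b) → (a , b) , c)) rank-u))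

-- Hybrids of two sets.

InMix : ∀ {n} → (Fin n → Set) → Subset n → Subset n → Fin n → Set
InMix W A B i = (W i × i ∈ A) ⊎ (¬ W i × i ∈ B)

inMix? : ∀ {n} {W : Fin n → Set} → (∀ i → Dec (W i)) → ∀ A B i → Dec (InMix W A B i)
inMix? W? A B i = (W? i ×-dec (i ∈? A)) ⊎-dec (¬? (W? i) ×-dec (i ∈? B))

mix : ∀ {n} {W : Fin n → Set} → (∀ i → Dec (W i)) → Subset n → Subset n → Subset n
mix W? A B = subset (inMix? W? A B)

∣mix∣ : ∀ {n} {W : Fin n → Set} (W? : ∀ i → Dec (W i)) A B →
        ∣ mix W? A B ∣ ≡ count (λ i → W? i ×-dec (i ∈? A)) + count (λ i → ¬? (W? i) ×-dec (i ∈? B))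
∣mix∣ W? A B = trans (∣subset∣ (inMix? W? A B)) (≤-antisym
  (count-cover (inMix? W? A B) (λ i → W? i ×-dec (i ∈? A)) (λ i → ¬? (W? i) ×-dec (i ∈? B)) (λ _ → id))
  (count-disjoint (inMix? W? A B) (λ i → W? i ×-dec (i ∈? A)) (λ i → ¬? (W? i) ×-dec (i ∈? B))
    (λ _ → inj₁) (λ _ → inj₂) (λ _ (w , _) (¬w , _) → ¬w w)))

∈-mix⁻ : ∀ {n} {W : Fin n → Set} (W? : ∀ i → Dec (W i)) A B i → i ∈ mix W? A B → InMix W A B i
∈-mix⁻ W? A B = ∈-subset⁻ (inMix? W? A B)

∈-mix⁺ : ∀ {n} {W : Fin n → Set} (W? : ∀ i → Dec (W i)) A B i → InMix W A B i → i ∈ mix W? A B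
∈-mix⁺ W? A B = ∈-subset⁺ (inMix? W? A B)

∣mix-self∣ : ∀ {n} {W : Fin n → Set} (W? : ∀ i → Dec (W i)) A →
             ∣ A ∣ ≡ count (λ i → W? i ×-dec (i ∈? A)) + count (λ i → ¬? (W? i) ×-dec (i ∈? A))
∣mix-self∣ W? A = trans ∣ A ∣≡count (≤-antisym
  (count-cover (_∈? A) (λ i → W? i ×-dec (i ∈? A)) (λ i → ¬? (W? i) ×-dec (i ∈? A)) split)
  (count-disjoint (_∈? A) (λ i → W? i ×-dec (i ∈? A)) (λ i → ¬? (W? i) ×-dec (i ∈? A))
    (λ _ → proj₂) (λ _ → proj₂) (λ _ (w , _) (¬w , _) → ¬w w)))
  where
  split : ∀ i → i ∈ A → _
  split i m with W? i
  ... | yes w = inj₁ (w , m)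
  ... | no ¬w = inj₂ (¬w , m)

-- Crossing and nesting of chords.

_Cross?_ : ∀ c d → Dec (Cross c d)
c Cross? d = ((left c <? left d) ×-dec ((left d <? right c) ×-dec (right c <? right d)))
       ⊎-dec ((left d <? left c) ×-dec ((left c <? right d) ×-dec (right d <? right c)))

cross-sym : ∀ c d → Cross c d → Cross d c
cross-sym _ _ (inj₁ h) = inj₂ h
cross-sym _ _ (inj₂ h) = inj₁ h

infix 4 _⊑_
_⊑_ : Chord → Chord → Set
c ⊑ d = left d ≤ left c × right c ≤ right d

_⊑?_ : ∀ c d → Dec (c ⊑ d)
c ⊑? d = (left d ≤? left c) ×-dec (right c ≤? right d)

⊑-trans : ∀ {c d e} → c ⊑ d → d ⊑ e → c ⊑ e
⊑-trans (a , b) (a′ , b′) = ≤-trans a′ a , ≤-trans b b′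

⊑⇒¬cross : ∀ {c d} → c ⊑ d → ¬ Cross c d
⊑⇒¬cross (a , b) (inj₁ (h , _))     = <⇒≱ h a
⊑⇒¬cross (a , b) (inj₂ (_ , _ , h)) = <⇒≱ h b

len : Chord → ℕ
len c = right c ∸ left c

-- Overlapping chords that do not cross are nested, and length decides which is the inner one.
-- Shared endpoints do not count as crossing, so a common end is treated separately in the mixed
-- cases.
len≤⇒⊑ : ∀ {c d} → left c < right d → left d < right c → ¬ Cross c d → len c ≤ len d → c ⊑ d
len≤⇒⊑ {c} {d} lc<rd ld<rc ¬x μ≤ with left d ≤? left c | right c ≤? right d
... | yes a | yes b = a , b
... | no ¬a | no ¬b = ⊥-elim (<⇒≱ (≤-<-trans
        (∸-monoʳ-≤ (right d) (<⇒≤ (≰⇒> ¬a))) (∸-monoˡ-< (≰⇒> ¬b) (<⇒≤ lc<rd))) μ≤)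
... | yes a | no ¬b with left d <? left c
...   | yes a′ = ⊥-elim (¬x (inj₂ (a′ , lc<rd , ≰⇒> ¬b)))
...   | no ¬a′ = ⊥-elim (<⇒≱ (∸-monoˡ-< (≰⇒> ¬b) (<⇒≤ (left<right d)))
                   (≤-trans (≤-reflexive (cong (right c ∸_) (≤-antisym a (≮⇒≥ ¬a′)))) μ≤))
len≤⇒⊑ {c} {d} lc<rd ld<rc ¬x μ≤ | no ¬a | yes b with right c <? right d
...   | yes b′ = ⊥-elim (¬x (inj₁ (≰⇒> ¬a , ld<rc , b′)))
...   | no ¬b′ = ⊥-elim (<⇒≱ (∸-monoʳ-< (≰⇒> ¬a) (<⇒≤ ld<rc))
                   (≤-trans μ≤ (≤-reflexive (cong (_∸ left d) (≤-antisym (≮⇒≥ ¬b′) b)))))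

-- Exchanges between independent sets.

module _ {n : ℕ} (G : CircleGraph n) where

  independent? : ∀ S → Dec (Independent G S)
  independent? S = all? λ i → all? λ j → (i ∈? S) →-dec ((j ∈? S) →-dec ¬? (chords G i Cross? chords G j))

  maximum? : ∀ S → Dec (MaximumIndependent G S)
  maximum? S = independent? S ×-dec
    map′ (λ ¬larger S′ ind → ≮⇒≥ (λ lt → ¬larger (S′ , ind , lt)))
         (λ max (S′ , ind , lt) → <⇒≱ lt (max S′ ind))
         (¬? (anySubset? (λ S′ → independent? S′ ×-dec (∣ S ∣ <? ∣ S′ ∣))))

  mix-independent : ∀ {W : Fin n → Set} (W? : ∀ i → Dec (W i)) A B →
    Independent G A → Independent G B →
    (∀ x y → W x → x ∈ A → ¬ W y → y ∈ B → ¬ Adj G x y) →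
    Independent G (mix W? A B)
  mix-independent W? A B indA indB h x y mx my with ∈-mix⁻ W? A B x mx | ∈-mix⁻ W? A B y my
  ... | inj₁ (_ , a)  | inj₁ (_ , a′)  = indA x y a a′
  ... | inj₁ (w , a)  | inj₂ (¬w , b)  = h x y w a ¬w b
  ... | inj₂ (¬w , b) | inj₁ (w , a)   = h y x w a ¬w b ∘ cross-sym (chords G x) (chords G y)
  ... | inj₂ (_ , b)  | inj₂ (_ , b′)  = indB x y b b′

  -- The hybrid is no larger than `B`, and the part of `B` outside `W` cancels on both sides.
  exchange-≤ : ∀ {W : Fin n → Set} (W? : ∀ i → Dec (W i)) A B → MaximumIndependent G B →
    Independent G (mix W? A B) →
    count (λ i → W? i ×-dec (i ∈? A)) ≤ count (λ i → W? i ×-dec (i ∈? B))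
  exchange-≤ W? A B (_ , maxB) ind = +-cancelʳ-≤ (count (λ i → ¬? (W? i) ×-dec (i ∈? B)))
    (count (λ i → W? i ×-dec (i ∈? A))) (count (λ i → W? i ×-dec (i ∈? B)))
    (subst₂ _≤_ (∣mix∣ W? A B) (∣mix-self∣ W? B) (maxB (mix W? A B) ind))

  -- The opposite hybrid shows that `A` has at least as many elements in `W` as `B`, so the exchange
  -- loses nothing against `B`.
  mix-maximum : ∀ {W : Fin n → Set} (W? : ∀ i → Dec (W i)) A B →
    MaximumIndependent G A → MaximumIndependent G B →
    Independent G (mix W? A B) → Independent G (mix W? B A) → MaximumIndependent G (mix W? A B)
  mix-maximum W? A B maxA (_ , maxB) ind ind′ = ind , λ S′ i → ≤-trans (maxB S′ i)
    (subst₂ _≤_ (sym (∣mix-self∣ W? B)) (sym (∣mix∣ W? A B))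
      (+-monoˡ-≤ (count (λ i → ¬? (W? i) ×-dec (i ∈? B))) (exchange-≤ W? B A maxA ind′)))

-- Monotonicity of ranks, and residues in an interval.

rank-< : ∀ {n} {Y : Fin n → Set} (Y? : ∀ i → Dec (Y i)) (μ : Fin n → ℕ) {x y} → Y y → μ x < μ y →
         count (λ v → Y? v ×-dec (μ y <? μ v)) < count (λ v → Y? v ×-dec (μ x <? μ v))
rank-< Y? μ {x} {y} yy lt = ≤-trans (≤-reflexive (cong (_+ count above?) (sym (count-singleton y))))
  (count-disjoint (λ v → Y? v ×-dec (μ x <? μ v)) (_≟ᶠ y) above?
    (λ { _ refl → yy , lt }) (λ _ (a , lt′) → a , <-trans lt lt′) (λ { _ refl (_ , lt′) → <-irrefl refl lt′ }))
  where
  above? = λ v → Y? v ×-dec (μ y <? μ v)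

-- The witness is `ρ` added to the last multiple of `w` up to `A`, or to the next multiple if that
-- falls short of `A`.
interval-∋-residue : ∀ w .{{_ : NonZero w}} A (ρ : Fin w) → ∃ λ t → A ≤ t × t < A + w × t % w ≡ toℕ ρ
interval-∋-residue w A ρ with A % w ≤? toℕ ρ
... | yes r≤ρ = toℕ ρ + A ℕ./ w * w ,
  ≤-trans (≤-reflexive (m≡m%n+[m/n]*n A w)) (+-monoˡ-≤ (A ℕ./ w * w) r≤ρ) ,
  <-≤-trans (+-mono-<-≤ (toℕ<n ρ) kw≤A) (≤-reflexive (+-comm w A)) ,
  trans ([m+kn]%n≡m%n (toℕ ρ) (A ℕ./ w) w) (m<n⇒m%n≡m (toℕ<n ρ))
  where
  kw≤A : A ℕ./ w * w ≤ A
  kw≤A = ≤-trans (m≤n+m _ (A % w)) (≤-reflexive (sym (m≡m%n+[m/n]*n A w)))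
... | no r≰ρ = toℕ ρ + suc (A ℕ./ w) * w ,
  ≤-trans (≤-reflexive (m≡m%n+[m/n]*n A w))
    (≤-trans (+-monoˡ-≤ (A ℕ./ w * w) (m%n≤n A w)) (m≤n+m _ (toℕ ρ))) ,
  <-≤-trans (+-monoˡ-< (suc (A ℕ./ w) * w) (≰⇒> r≰ρ)) (≤-reflexive shift) ,
  trans ([m+kn]%n≡m%n (toℕ ρ) (suc (A ℕ./ w)) w) (m<n⇒m%n≡m (toℕ<n ρ))
  where
  shift : A % w + (w + A ℕ./ w * w) ≡ A + w
  shift = trans (cong (λ z → A % w + z) (+-comm w _))
    (trans (sym (+-assoc (A % w) _ w)) (cong (_+ w) (sym (m≡m%n+[m/n]*n A w))))

-- Classes of chords for a division into arcs, none containing a chord.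

module Arcs {n : ℕ} (G : CircleGraph n) (arc : ℕ → ℕ)
            (arc-mono : ∀ {x y} → x ≤ y → arc x ≤ arc y)
            (arc-chord : ∀ i → arc (left (chords G i)) < arc (right (chords G i))) where

  L R μ : Fin n → ℕ
  L i = left (chords G i)
  R i = right (chords G i)
  μ i = len (chords G i)

  Same : Fin n → Fin n → Set
  Same x y = arc (L x) ≡ arc (L y) × arc (R x) ≡ arc (R y)

  same? : ∀ x y → Dec (Same x y)
  same? x y = (arc (L x) ≟ arc (L y)) ×-dec (arc (R x) ≟ arc (R y))

  same-sym : ∀ {x y} → Same x y → Same y x
  same-sym (a , b) = sym a , sym b

  same-trans : ∀ {x y z} → Same x y → Same y z → Same x z
  same-trans (a , b) (a′ , b′) = trans a a′ , trans b b′

  -- Otherwise monotonicity would squeeze both ends of `y` into one arc. Hence chords of one class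
  -- overlap, and non-crossing ones are nested.
  same⇒L<R : ∀ {x y} → Same x y → L x < R y
  same⇒L<R {x} {y} (a , _) = ≰⇒> λ Ry≤Lx →
    <⇒≱ (arc-chord y) (≤-trans (arc-mono Ry≤Lx) (≤-reflexive a))

  same⇒⊑ : ∀ x y → Same x y → ¬ Adj G x y → μ x ≤ μ y → chords G x ⊑ chords G y
  same⇒⊑ x y s = len≤⇒⊑ {chords G x} {chords G y} (same⇒L<R s) (same⇒L<R (same-sym s))

  -- Equal lengths give nesting both ways, hence equal endpoints, and chords are determined by their
  -- endpoints.
  μ-injective : ∀ {S} → Independent G S → ∀ {x y} → x ∈ S → y ∈ S → Same x y → μ x ≡ μ y → x ≡ y
  μ-injective ind {x} {y} x∈S y∈S s e with same⇒⊑ x y s (ind x y x∈S y∈S) (≤-reflexive e)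
                                         | same⇒⊑ y x (same-sym s) (ind y x y∈S x∈S) (≤-reflexive (sym e))
  ... | a , b | a′ , b′ = distinct G x y (≤-antisym a′ a) (≤-antisym b b′)

  Strip : Fin n → Fin n → Fin n → Set
  Strip z z′ x = chords G z ⊑ chords G x × chords G x ⊑ chords G z′

  strip? : ∀ z z′ x → Dec (Strip z z′ x)
  strip? z z′ x = (chords G z ⊑? chords G x) ×-dec (chords G x ⊑? chords G z′)

  strip⇒same : ∀ {z z′ x} → Same z z′ → Strip z z′ x → Same z x
  strip⇒same (a , b) ((c , d) , (e , f)) =
    ≤-antisym (≤-trans (≤-reflexive a) (arc-mono e)) (arc-mono c) ,
    ≤-antisym (arc-mono d) (≤-trans (arc-mono f) (≤-reflexive (sym b)))

  -- y would have to enter the region between z and z′; since z and z′ have their left ends in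
  -- one arc and their right ends in another, y would then lie in the strip or within one arc.
  strip-separates : ∀ {z z′} → Same z z′ → ∀ x y → Strip z z′ x → ¬ Strip z z′ y →
                    ¬ Adj G z y → ¬ Adj G z′ y → ¬ Adj G x y
  strip-separates {z} {z′} (aL , aR) x y ((z₁ , z₂) , (z₃ , z₄)) y∉ ¬zy ¬z′y (inj₁ (lx<ly , ly<rx , rx<ry))
    with R y ≤? R z′ | L y ≤? L z | L y <? R z
  ... | no ry≰rz′ | _ | _ = ¬z′y (inj₁ (≤-<-trans z₃ lx<ly , <-≤-trans ly<rx z₄ , ≰⇒> ry≰rz′))
  ... | yes ry≤rz′ | yes ly≤lz | _ =
    y∉ ((ly≤lz , ≤-trans z₂ (<⇒≤ rx<ry)) , (≤-trans z₃ (<⇒≤ lx<ly) , ry≤rz′))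
  ... | yes ry≤rz′ | no ly≰lz | yes ly<rz = ¬zy (inj₁ (≰⇒> ly≰lz , ly<rz , ≤-<-trans z₂ rx<ry))
  ... | yes ry≤rz′ | no ly≰lz | no ly≮rz = <⇒≱ (arc-chord y)
    (≤-trans (arc-mono ry≤rz′) (≤-trans (≤-reflexive (sym aR)) (arc-mono (≮⇒≥ ly≮rz))))
  strip-separates {z} {z′} (aL , aR) x y ((z₁ , z₂) , (z₃ , z₄)) y∉ ¬zy ¬z′y (inj₂ (ly<lx , lx<ry , ry<rx))
    with L z′ ≤? L y | R z ≤? R y | L z <? R y
  ... | no lz′≰ly | _ | _ = ¬z′y (inj₂ (≰⇒> lz′≰ly , ≤-<-trans z₃ lx<ry , <-≤-trans ry<rx z₄))
  ... | yes lz′≤ly | yes rz≤ry | _ =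
    y∉ ((≤-trans (<⇒≤ ly<lx) z₁ , rz≤ry) , (lz′≤ly , ≤-trans (<⇒≤ ry<rx) z₄))
  ... | yes lz′≤ly | no rz≰ry | yes lz<ry = ¬zy (inj₂ (<-≤-trans ly<lx z₁ , lz<ry , ≰⇒> rz≰ry))
  ... | yes lz′≤ly | no rz≰ry | no lz≮ry = <⇒≱ (arc-chord y)
    (≤-trans (arc-mono (≮⇒≥ lz≮ry)) (≤-trans (≤-reflexive aL) (arc-mono lz′≤ly)))

  -- Both boundary chords lie in `B`, so no chord of `B` outside the strip crosses them, and none
  -- can reach a chord of `A` inside.
  strip-mix : ∀ {z z′ A B} → Same z z′ → Independent G A → Independent G B → z ∈ B → z′ ∈ B →
              Independent G (mix (strip? z z′) A B)
  strip-mix {z} {z′} {A} {B} s indA indB z∈B z′∈B = mix-independent G (strip? z z′) A B indA indB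
    λ x y x∈W _ y∉W y∈B → strip-separates s x y x∈W y∉W (indB z y z∈B y∈B) (indB z′ y z′∈B y∈B)

  -- The depth of `u` in its chain, counted from outside: when `S` is independent and contains `u`,
  -- the longer chords of `S` in the class are those enclosing `u`.
  rank : Subset n → Fin n → ℕ
  rank S u = count (λ v → (same? u v ×-dec (μ u <? μ v)) ×-dec (v ∈? S))

  -- Depth as an invariant, and its residue classes.

  module Levels (γ : Subset n) (γ-max : MaximumIndependent G γ) where

    ExtendsOutside : Fin n → Subset n → Set
    ExtendsOutside u S = MaximumIndependent G S × u ∈ S ×
      (∀ x → ¬ Same u x → (x ∈ S → x ∈ γ) × (x ∈ γ → x ∈ S))

    extendsOutside? : ∀ u S → Dec (ExtendsOutside u S)
    extendsOutside? u S = maximum? G S ×-dec ((u ∈? S) ×-dec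
      all? λ x → ¬? (same? u x) →-dec (((x ∈? S) →-dec (x ∈? γ)) ×-dec ((x ∈? γ) →-dec (x ∈? S))))

    -- Graft the chords of `S` outside `u` in its class onto `S′`. Off the class the two sets agree;
    -- within it, the chords kept from `S′` lie inside `u` and the grafted ones enclose it, so
    -- nothing crosses.
    rank-≤ : ∀ {u S S′} → ExtendsOutside u S → ExtendsOutside u S′ → rank S u ≤ rank S′ u
    rank-≤ {u} {S} {S′} (max , u∈S , off) (max′ , u∈S′ , off′) =
      exchange-≤ G above? S S′ max′ (mix-independent G above? S S′ (proj₁ max) (proj₁ max′) separate)
      where
      above? = λ v → same? u v ×-dec (μ u <? μ v)
      separate : ∀ x y → Same u x × μ u < μ x → x ∈ S → ¬ (Same u y × μ u < μ y) → y ∈ S′ → ¬ Adj G x y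
      separate x y (sx , lt) x∈S y∉ y∈S′ with same? u y
      ... | no ¬sy = proj₁ max x y x∈S (proj₂ (off y ¬sy) (proj₁ (off′ y ¬sy) y∈S′))
      ... | yes sy = ⊑⇒¬cross {chords G y} {chords G x} (⊑-trans {chords G y} {chords G u} {chords G x}
              (same⇒⊑ y u (same-sym sy) (proj₁ max′ y u y∈S′ u∈S′) (≮⇒≥ (λ lt′ → y∉ (sy , lt′))))
              (same⇒⊑ u x sx (proj₁ max u x u∈S x∈S) (<⇒≤ lt))) ∘ cross-sym (chords G x) (chords G y)

    rank-unique : ∀ {u S S′} → ExtendsOutside u S → ExtendsOutside u S′ → rank S u ≡ rank S′ u
    rank-unique e e′ = ≤-antisym (rank-≤ e e′) (rank-≤ e′ e)

    module Residues (w : ℕ) .{{_ : NonZero w}} where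

      -- The witness `S` is arbitrary, as `rank-unique` makes the depth independent of it. So a
      -- level depends on `γ` alone and is fixed before the sets that it has to meet.
      Level : Fin w → Fin n → Set
      Level ρ u = ∃ λ S → ExtendsOutside u S × rank S u % w ≡ toℕ ρ

      level? : ∀ ρ u → Dec (Level ρ u)
      level? ρ u = anySubset? λ S → extendsOutside? u S ×-dec (rank S u % w ≟ toℕ ρ)

      level-unique : ∀ ρ ρ′ u → Level ρ u → Level ρ′ u → ρ ≡ ρ′
      level-unique ρ ρ′ u (S , e , r) (S′ , e′ , r′) = toℕ-injective
        (trans (sym r) (trans (cong (_% w) (rank-unique e e′)) r′))

      -- Let `z` and `z′` be the shortest and longest chords of `X`. The hybrid following `S`
      -- between them and `γ` elsewhere has all depths from that of `z′` to that of `z` in this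
      -- class, at least `w` consecutive values, and the chords at these depths come from `S`.
      level-met : ∀ ρ {S} → MaximumIndependent G S → ∀ {X : Fin n → Set} (X? : ∀ i → Dec (X i)) →
                  (∀ i → X i → i ∈ S × i ∈ γ) → (∀ x y → X x → X y → Same x y) → w ≤ count X? →
                  ∃ λ u → u ∈ S × Level ρ u
      level-met ρ {S} S-max {X} X? X⊆ X-same w≤#X = between (argmin X? μ X-nonempty) (argmax X? μ X-nonempty)
        where
        X-nonempty : ∃ X
        X-nonempty = count-positive X? (<-≤-trans (>-nonZero⁻¹ w) w≤#X)

        between : (∃ λ z → X z × (∀ y → X y → μ z ≤ μ y)) → (∃ λ z′ → X z′ × (∀ y → X y → μ y ≤ μ z′)) →
                  ∃ λ u → u ∈ S × Level ρ u
        between (z , xz , z-min) (z′ , xz′ , z′-max) = finish (rank-exists t Y? μ Y-injective t<#Y)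
          where
          S″ = mix (strip? z z′) S γ
          Y? = λ v → (v ∈? S″) ×-dec same? z v
          zSz′ = X-same z z′ xz xz′
          A = count (λ v → Y? v ×-dec (μ z′ <? μ v))
          B = count (λ v → Y? v ×-dec (μ z <? μ v))

          residue = interval-∋-residue w A ρ
          t = proj₁ residue
          A≤t = proj₁ (proj₂ residue)
          t<A+w = proj₁ (proj₂ (proj₂ residue))
          t%w≡ρ = proj₂ (proj₂ (proj₂ residue))

          S″-max : MaximumIndependent G S″
          S″-max = mix-maximum G (strip? z z′) S γ S-max γ-max
            -- Both hybrids are independent because `z` and `z′` belong to `S` and to `γ`.
            (strip-mix zSz′ (proj₁ S-max) (proj₁ γ-max) (proj₂ (X⊆ z xz)) (proj₂ (X⊆ z′ xz′)))
            (strip-mix zSz′ (proj₁ γ-max) (proj₁ S-max) (proj₁ (X⊆ z xz)) (proj₁ (X⊆ z′ xz′)))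

          both : ∀ x → x ∈ S → x ∈ γ → x ∈ S″
          both x x∈S x∈γ with strip? z z′ x
          ... | yes W = ∈-mix⁺ (strip? z z′) S γ x (inj₁ (W , x∈S))
          ... | no ¬W = ∈-mix⁺ (strip? z z′) S γ x (inj₂ (¬W , x∈γ))

          X⊆Y : ∀ x → X x → x ∈ S″ × Same z x
          X⊆Y x xx = both x (proj₁ (X⊆ x xx)) (proj₂ (X⊆ x xx)) , X-same z x xz xx

          Y-injective : ∀ x y → x ∈ S″ × Same z x → y ∈ S″ × Same z y → μ x ≡ μ y → x ≡ y
          Y-injective x y (x∈ , sx) (y∈ , sy) = μ-injective (proj₁ S″-max) x∈ y∈ (same-trans (same-sym sx) sy)

          #X+A≤1+B : count X? + A ≤ suc B
          -- `X` and the chords longer than `z′` are disjoint and at least as long as `z`; the extra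
          -- one on the right is `z` itself, which `B` does not count.
          #X+A≤1+B = ≤-trans
            (count-disjoint (λ v → Y? v ×-dec (μ z ≤? μ v)) X? (λ v → Y? v ×-dec (μ z′ <? μ v))
              (λ x xx → X⊆Y x xx , z-min x xx)
              (λ _ (y , lt) → y , ≤-trans (z-min z′ xz′) (<⇒≤ lt))
              (λ x xx (_ , lt) → <⇒≱ lt (z′-max x xx)))
            (≤-trans (count-cover (λ v → Y? v ×-dec (μ z ≤? μ v)) (_≟ᶠ z) (λ v → Y? v ×-dec (μ z <? μ v)) split)
              (≤-reflexive (cong (_+ B) (count-singleton z))))
            where
            split : ∀ v → (v ∈ S″ × Same z v) × μ z ≤ μ v → v ≡ z ⊎ ((v ∈ S″ × Same z v) × μ z < μ v)
            split v (y , le) with v ≟ᶠ z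
            ... | yes e = inj₁ e
            ... | no ne = inj₂ (y , ≤∧≢⇒< le (ne ∘ sym ∘ Y-injective z v (X⊆Y z xz) y))

          t≤B : t ≤ B
          t≤B = ≤-pred (≤-trans t<A+w (≤-trans (+-monoʳ-≤ A w≤#X) (≤-trans (≤-reflexive (+-comm A _)) #X+A≤1+B)))

          t<#Y : t < count Y?
          t<#Y = ≤-trans (s≤s t≤B) (≤-trans (≤-reflexive (cong (_+ B) (sym (count-singleton z))))
            (count-disjoint Y? (_≟ᶠ z) (λ v → Y? v ×-dec (μ z <? μ v))
              (λ { _ refl → X⊆Y z xz }) (λ _ → proj₁) (λ { _ refl (_ , lt) → <-irrefl refl lt })))

          finish : (∃ λ u → (u ∈ S″ × Same z u) × count (λ v → Y? v ×-dec (μ u <? μ v)) ≡ t) →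
                   ∃ λ u → u ∈ S × Level ρ u
          finish (u , (u∈S″ , zSu) , rank-u) = u , u∈S , S″ , (S″-max , u∈S″ , agrees) ,
            trans (cong (_% w) (trans rank≡ rank-u)) t%w≡ρ
            where
            μz≤μu : μ z ≤ μ u
            μz≤μu = ≮⇒≥ λ lt → <⇒≱ (rank-< Y? μ {u} {z} (X⊆Y z xz) lt) (≤-trans (≤-reflexive rank-u) t≤B)
            μu≤μz′ : μ u ≤ μ z′
            μu≤μz′ = ≮⇒≥ λ lt → <⇒≱ (rank-< Y? μ {z′} {u} (u∈S″ , zSu) lt) (≤-trans A≤t (≤-reflexive (sym rank-u)))
            z∈S″ = proj₁ (X⊆Y z xz)
            z′∈S″ = proj₁ (X⊆Y z′ xz′)
            u∈S : u ∈ S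
            u∈S with ∈-mix⁻ (strip? z z′) S γ u u∈S″
            ... | inj₁ (_ , u∈S) = u∈S
            -- Rank decreases with length, so `u` has length between those of `z` and `z′`; being
            -- nested with both, it lies in the strip.
            ... | inj₂ (¬W , _)  = ⊥-elim (¬W
              ( same⇒⊑ z u zSu (proj₁ S″-max z u z∈S″ u∈S″) μz≤μu
              , same⇒⊑ u z′ (same-trans (same-sym zSu) zSz′) (proj₁ S″-max u z′ u∈S″ z′∈S″) μu≤μz′))
            agrees : ∀ x → ¬ Same u x → (x ∈ S″ → x ∈ γ) × (x ∈ γ → x ∈ S″)
            agrees x ¬s = to , λ x∈γ → ∈-mix⁺ (strip? z z′) S γ x (inj₂ (¬W , x∈γ))
              where
              ¬W : ¬ Strip z z′ x
              ¬W W = ¬s (same-trans (same-sym zSu) (strip⇒same zSz′ W))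
              to : x ∈ S″ → x ∈ γ
              to x∈ with ∈-mix⁻ (strip? z z′) S γ x x∈
              ... | inj₁ (W , _)   = contradiction W ¬W
              ... | inj₂ (_ , x∈γ) = x∈γ
            rank≡ : rank S″ u ≡ count (λ v → Y? v ×-dec (μ u <? μ v))
            rank≡ = count-cong (λ v → (same? u v ×-dec (μ u <? μ v)) ×-dec (v ∈? S″)) (λ v → Y? v ×-dec (μ u <? μ v))
              (λ _ ((s , lt) , m) → (m , same-trans zSu s) , lt)
              (λ _ ((m , s) , lt) → (same-trans (same-sym zSu) s , lt) , m)

      -- Pigeonhole: the `w` levels are pairwise disjoint, so the smallest has at most `n` / `w`
      -- elements.
      small-level : ∃ λ ρ → w * count (level? ρ) ≤ n
      small-level with argmin {w} (λ _ → yes tt) (λ ρ → count (level? ρ)) (fromℕ< (>-nonZero⁻¹ w) , tt)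
      ... | ρ , _ , least = ρ , ≤-trans (∑-≥ w (λ ρ′ → count (level? ρ′)) (λ ρ′ → least ρ′ tt))
        (≤-trans (∑-disjoint w {Q = λ _ → ⊤₁} (λ _ → yes tt) level? (λ _ _ _ → tt) level-unique) (count≤n {n} (λ _ → yes tt)))

  -- Counting the classes met by an independent set.

  -- For x ∈ γ: the class of x is not the longest one of γ issuing from its left arc.  Then it is
  -- the longest one ending in its right arc, so the classes met by γ inject into two copies
  -- of the set of arcs.
  RightType : Subset n → Fin n → Set
  RightType γ x = ∃ λ y → y ∈ γ × arc (L y) ≡ arc (L x) × arc (R x) < arc (R y)

  rightType? : ∀ γ x → Dec (RightType γ x)
  rightType? γ x = any? λ y → (y ∈? γ) ×-dec ((arc (L y) ≟ arc (L x)) ×-dec (arc (R x) <? arc (R y)))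

  ¬rightType-same : ∀ γ {x y} → x ∈ γ → y ∈ γ → ¬ RightType γ x → ¬ RightType γ y →
                    arc (L x) ≡ arc (L y) → Same x y
  ¬rightType-same γ {x} {y} x∈ y∈ ¬rx ¬ry e = e ,
    ≤-antisym (≮⇒≥ (λ lt → ¬ry (x , x∈ , e , lt))) (≮⇒≥ (λ lt → ¬rx (y , y∈ , sym e , lt)))

  arc-<⇒< : ∀ {p q} → arc p < arc q → p < q
  arc-<⇒< lt = ≰⇒> (λ q≤p → <⇒≱ lt (arc-mono q≤p))

  -- If `x` began in an earlier arc than `y`, the longer chord `y′` witnessing `RightType` for `y`
  -- would start inside `x` and end beyond it, crossing `x`.
  rightType-≤ : ∀ {γ} → Independent G γ → ∀ {x y} → x ∈ γ → y ∈ γ → RightType γ y →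
                arc (R x) ≡ arc (R y) → arc (L y) ≤ arc (L x)
  rightType-≤ ind {x} {y} x∈ y∈ (y′ , y′∈ , e , lt) eR = ≮⇒≥ λ Lx<Ly → ind x y′ x∈ y′∈
    (inj₁ ( arc-<⇒< (<-≤-trans Lx<Ly (≤-reflexive (sym e)))
          , arc-<⇒< (≤-<-trans (≤-reflexive e) (<-≤-trans (arc-chord y) (≤-reflexive (sym eR))))
          , arc-<⇒< (≤-<-trans (≤-reflexive eR) lt)))

  rightType-same : ∀ {γ} → Independent G γ → ∀ {x y} → x ∈ γ → y ∈ γ → RightType γ x → RightType γ y →
                   arc (R x) ≡ arc (R y) → Same x y
  rightType-same ind x∈ y∈ rx ry e =
    ≤-antisym (rightType-≤ ind y∈ x∈ rx (sym e)) (rightType-≤ ind x∈ y∈ ry e) , e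

  -- For chords of right type the right arc fixes the class, for the others the left arc does. Each
  -- kind therefore meets at most `suc m` classes, one per arc label from 0 to `m`.
  classes-bound : ∀ m → (∀ p → arc p ≤ m) → ∀ {γ} → Independent G γ → ∀ w {Z : Fin n → Set} (Z? : ∀ i → Dec (Z i)) →
    (∀ i → Z i → i ∈ γ) →
    (∀ {X : Fin n → Set} (X? : ∀ i → Dec (X i)) → (∀ i → X i → Z i) → (∀ x y → X x → X y → Same x y) → count X? ≤ w) →
    count Z? ≤ suc m * w + suc m * w
  classes-bound m arc≤m {γ} ind w {Z} Z? Z⊆γ small = ≤-trans (count-cover Z? right? left? split)
    (+-mono-≤
      (≤-trans (∑-cover (suc m) right? rightAt? (λ i r → fromℕ< (s≤s (arc≤m (R i))) , r , sym (toℕ-fromℕ< _)))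
        (∑-≤ (suc m) _ (λ j → small (rightAt? j) (λ _ r → proj₁ (proj₁ r))
          (λ x y ((zx , rx) , ex) ((zy , ry) , ey) →
            rightType-same ind (Z⊆γ x zx) (Z⊆γ y zy) rx ry (trans ex (sym ey))))))
      (≤-trans (∑-cover (suc m) left? leftAt? (λ i r → fromℕ< (s≤s (arc≤m (L i))) , r , sym (toℕ-fromℕ< _)))
        (∑-≤ (suc m) _ (λ j → small (leftAt? j) (λ _ r → proj₁ (proj₁ r))
          (λ x y ((zx , rx) , ex) ((zy , ry) , ey) →
            ¬rightType-same γ (Z⊆γ x zx) (Z⊆γ y zy) rx ry (trans ex (sym ey)))))))
    where
    right? = λ i → Z? i ×-dec rightType? γ i
    left? = λ i → Z? i ×-dec ¬? (rightType? γ i)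
    rightAt? = λ (j : Fin (suc m)) i → right? i ×-dec (arc (R i) ≟ toℕ j)
    leftAt? = λ (j : Fin (suc m)) i → left? i ×-dec (arc (L i) ≟ toℕ j)
    split : ∀ i → Z i → _ ⊎ _
    split i z with rightType? γ i
    ... | yes r = inj₁ (z , r)
    ... | no ¬r = inj₂ (z , ¬r)

  local-hitting-set : ∀ m → (∀ p → arc p ≤ m) → ∀ {γ} → MaximumIndependent G γ → ∀ w .{{_ : NonZero w}} →
    Σ (Subset n) λ T → w * ∣ T ∣ ≤ n ×
      (∀ S → MaximumIndependent G S → (∀ i → i ∈ S → i ∉ T) →
        count (λ i → (i ∈? S) ×-dec (i ∈? γ)) ≤ suc m * w + suc m * w)
  local-hitting-set m arc≤m {γ} γ-max w = from-level small-level
    where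
    open Levels γ γ-max
    open Residues w
    from-level : (∃ λ ρ → w * count (level? ρ) ≤ n) → _
    from-level (ρ , w*#≤n) = T , subst (λ k → w * k ≤ n) (sym (∣subset∣ (level? ρ))) w*#≤n ,
      λ S S-max missed → classes-bound m arc≤m (proj₁ γ-max) w (λ i → (i ∈? S) ×-dec (i ∈? γ)) (λ _ → proj₂)
        λ X? X⊆ X-same → <⇒≤ (≰⇒> λ w≤#X → unmet S missed (level-met ρ S-max X? X⊆ X-same w≤#X))
      where
      T = subset (level? ρ)
      unmet : ∀ S → (∀ i → i ∈ S → i ∉ T) → ¬ ∃ λ u → u ∈ S × Level ρ u
      unmet S missed (u , u∈S , lev) = missed u u∈S (∈-subset⁺ (level? ρ) u lev)

-- Closed neighbourhoods as hitting sets.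

module _ {n : ℕ} (G : CircleGraph n) where

  private
    L R : Fin n → ℕ
    L i = left (chords G i)
    R i = right (chords G i)

  Missed : Subset n → Subset n → Set
  Missed T S = ∀ i → i ∈ S → i ∉ T

  -- Searching all subsets decides the alternative constructively, and its second branch supplies
  -- the next `γ` in the iteration.
  hitting-or-missed : ∀ T → HittingSet G T ⊎ ∃ λ S → MaximumIndependent G S × Missed T S
  hitting-or-missed T with anySubset? (λ S → maximum? G S ×-dec all? (λ i → (i ∈? S) →-dec ¬? (i ∈? T)))
  ... | yes missed = inj₂ missed
  ... | no ¬missed = inj₁ hits
    where
    hits : HittingSet G T
    hits S S-max with nonempty? (T ⊓ˢ S)
    ... | yes ne = ne
    ... | no ¬ne = ⊥-elim (¬missed (S , S-max , λ i i∈S i∈T → ¬ne (i , x∈p∩q⁺ (i∈T , i∈S))))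

  closed? : ∀ v i → Dec (i ≡ v ⊎ Adj G v i)
  closed? v i = (i ≟ᶠ v) ⊎-dec (chords G v Cross? chords G i)

  neighbourhood-hits : ∀ v → HittingSet G (subset (closed? v))
  neighbourhood-hits v with hitting-or-missed (subset (closed? v))
  ... | inj₁ hits = hits
  ... | inj₂ (S , (S-ind , S-max) , missed) = ⊥-elim (<⇒≱ larger (S-max S+v S+v-ind))
    where
    member? = λ i → (i ∈? S) ⊎-dec (i ≟ᶠ v)
    S+v = subset member?
    v∉S : v ∉ S
    v∉S v∈S = missed v v∈S (∈-subset⁺ (closed? v) v (inj₁ refl))
    ¬adj : ∀ i → i ∈ S → ¬ Adj G v i
    ¬adj i i∈S adj = missed i i∈S (∈-subset⁺ (closed? v) i (inj₂ adj))
    S+v-ind : Independent G S+v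
    S+v-ind i j i∈ j∈ with ∈-subset⁻ member? i i∈ | ∈-subset⁻ member? j j∈
    ... | inj₁ i∈S  | inj₁ j∈S  = S-ind i j i∈S j∈S
    ... | inj₁ i∈S  | inj₂ refl = ¬adj i i∈S ∘ cross-sym (chords G i) (chords G v)
    ... | inj₂ refl | inj₁ j∈S  = ¬adj j j∈S
    ... | inj₂ refl | inj₂ refl = ⊑⇒¬cross {chords G v} {chords G v} (≤-refl , ≤-refl)
    larger : ∣ S ∣ < ∣ S+v ∣
    larger = subst₂ _≤_ (cong₂ _+_ (count-singleton v) (sym ∣ S ∣≡count)) (sym (∣subset∣ member?))
      (count-disjoint member? (_≟ᶠ v) (_∈? S) (λ _ → inj₂) (λ _ → inj₁) (λ { _ refl → v∉S }))

  -- Cutting the circle by a greedy sweep.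

  -- Chords V with pairwise disjoint interiors whose right endpoints cut the line from x on
  -- into arcs [p , q), none of which contains both endpoints of a chord.
  record Sweep (x : ℕ) : Set where
    field
      size    : ℕ
      V       : Fin size → Fin n
      after   : ∀ k → x ≤ L (V k)
      ordered : ∀ k l → toℕ k < toℕ l → R (V k) ≤ L (V l)
      stabs   : ∀ c → x ≤ L c → ∃ λ k → L c < R (V k) × R (V k) ≤ R c
  open Sweep

  -- Greedy stabbing: choose the chord `v` starting at or after `x` with the least right end, and
  -- restart there. A chord starting before `R v` ends no earlier than `R v` by minimality, so that
  -- point stabs it.
  sweep : ∀ fuel x → (∀ c → R c ≤ x + fuel) → Sweep x
  sweep fuel x R≤ with any? (λ c → x ≤? L c)
  ... | no none = record
    { size = 0 ; V = λ () ; after = λ () ; ordered = λ ()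
    ; stabs = λ c x≤L → ⊥-elim (none (c , x≤L)) }
  sweep zero x R≤ | yes (c , x≤L) =
    ⊥-elim (<⇒≱ (≤-<-trans x≤L (left<right (chords G c))) (≤-trans (R≤ c) (≤-reflexive (+-identityʳ x))))
  sweep (suc fuel) x R≤ | yes some with argmin (λ c → x ≤? L c) R some
  ... | v , x≤Lv , first = record
    { size = suc (size rest) ; V = V′ ; after = after′ ; ordered = ordered′ ; stabs = stabs′ }
    where
    x<Rv : x < R v
    x<Rv = ≤-<-trans x≤Lv (left<right (chords G v))
    rest : Sweep (R v)
    rest = sweep fuel (R v) λ c →
      ≤-trans (R≤ c) (≤-trans (≤-reflexive (+-suc x fuel)) (+-monoˡ-≤ fuel x<Rv))
    V′ : Fin (suc (size rest)) → Fin n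
    V′ zero    = v
    V′ (suc k) = V rest k
    after′ : ∀ k → x ≤ L (V′ k)
    after′ zero    = x≤Lv
    after′ (suc k) = ≤-trans (<⇒≤ x<Rv) (after rest k)
    ordered′ : ∀ k l → toℕ k < toℕ l → R (V′ k) ≤ L (V′ l)
    ordered′ zero    (suc l) _         = after rest l
    ordered′ (suc k) (suc l) (s≤s k<l) = ordered rest k l k<l
    stabs′ : ∀ c → x ≤ L c → ∃ λ k → L c < R (V′ k) × R (V′ k) ≤ R c
    stabs′ c x≤L with L c <? R v
    ... | yes lt = zero , lt , first c x≤L
    ... | no ge with stabs rest c (≮⇒≥ ge)
    ...   | k , p = suc k , p

  module Swept (s : Sweep 0) where

    -- Arcs are numbered by the cut points up to `p`; the point stabbing a chord is counted at its
    -- right end and not at its left.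
    arc : ℕ → ℕ
    arc p = count (λ k → R (V s k) ≤? p)

    arc-mono : ∀ {p q} → p ≤ q → arc p ≤ arc q
    arc-mono {p} {q} p≤q = count-mono (λ k → R (V s k) ≤? p) (λ k → R (V s k) ≤? q) (λ _ h → ≤-trans h p≤q)

    arc-chord : ∀ c → arc (L c) < arc (R c)
    arc-chord c with stabs s c z≤n
    ... | k , L<RV , RV≤R = ≤-trans (s≤s
      (count-mono (λ j → R (V s j) ≤? L c) (λ j → (R (V s j) ≤? R c) ×-dec ¬? (j ≟ᶠ k))
        (λ _ h → ≤-trans h (<⇒≤ (left<right (chords G c))) , λ { refl → <⇒≱ L<RV h })))
      (≤-reflexive (sym (count-remove (λ j → R (V s j) ≤? R c) k RV≤R)))

    arc≤size : ∀ p → arc p ≤ size s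
    arc≤size p = count≤n (λ k → R (V s k) ≤? p)

    -- Half-open, because one sweep chord may begin where another ends, while its own left end has
    -- to be counted.
    Within : Fin (size s) → ℕ → Set
    Within k p = L (V s k) ≤ p × p < R (V s k)

    within? : ∀ k p → Dec (Within k p)
    within? k p = (L (V s k) ≤? p) ×-dec (p <? R (V s k))

    within-unique : ∀ j k p → Within j p → Within k p → j ≡ k
    within-unique j k p (a , b) (a′ , b′) with <-cmp (toℕ j) (toℕ k)
    ... | tri< lt _ _ = ⊥-elim (<⇒≱ b (≤-trans (ordered s j k lt) a′))
    ... | tri≈ _ e _  = toℕ-injective e
    ... | tri> _ _ gt = ⊥-elim (<⇒≱ b′ (≤-trans (ordered s k j gt) a))

    -- Every member of the closed neighbourhood of a sweep chord has an end in its interval. The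
    -- intervals are disjoint, so each of the 2`n` chord ends is used at most once.
    size-bound : ∀ D → (∀ v → D ≤ count (closed? v)) → size s * D ≤ n + n
    size-bound D large = ≤-trans (∑-≥ (size s) (λ k → left# k + right# k) degree)
      (≤-trans (≤-reflexive (∑-distrib-+ left# right#)) (+-mono-≤ (total L) (total R)))
      where
      left# right# : Fin (size s) → ℕ
      left# k = count (λ c → within? k (L c))
      right# k = count (λ c → within? k (R c))
      degree : ∀ k → D ≤ left# k + right# k
      degree k = ≤-trans (large (V s k))
        (count-cover (closed? (V s k)) (λ c → within? k (L c)) (λ c → within? k (R c)) locate)
        where
        locate : ∀ c → c ≡ V s k ⊎ Adj G (V s k) c → Within k (L c) ⊎ Within k (R c)
        locate c (inj₁ refl) = inj₁ (≤-refl , left<right (chords G c))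
        locate c (inj₂ (inj₁ (a , b , _))) = inj₁ (<⇒≤ a , b)
        locate c (inj₂ (inj₂ (_ , b , d))) = inj₂ (<⇒≤ b , d)
      total : ∀ (f : Fin n → ℕ) → sum (λ k → count (λ c → within? k (f c))) ≤ n
      total f = ≤-trans (∑-disjoint (size s) {Q = λ _ → ⊤₁} (λ _ → yes tt) (λ k c → within? k (f c))
        (λ _ _ _ → tt) (λ j k c → within-unique j k (f c))) (count≤n {n} (λ _ → yes tt))

  small-intersections : 0 < n → ∀ D → (∀ v → D ≤ count (closed? v)) → ∃ λ m → m * D ≤ n + n ×
    (∀ {γ} → MaximumIndependent G γ → ∀ w .{{_ : NonZero w}} →
      Σ (Subset n) λ T → w * ∣ T ∣ ≤ n × (∀ S → MaximumIndependent G S → Missed T S →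
        count (λ i → (i ∈? S) ×-dec (i ∈? γ)) ≤ suc m * w + suc m * w))
  small-intersections 0<n D large with argmax {n} (λ _ → yes tt) R (fromℕ< 0<n , tt)
  ... | c , _ , R≤ = size s , size-bound D large , local-hitting-set (size s) arc≤size
    where
    s : Sweep 0
    -- The largest right end is enough fuel.
    s = sweep (R c) 0 (λ c → R≤ c tt)
    open Swept s
    open Arcs G arc arc-mono arc-chord using (local-hitting-set)

  -- Iterating over missed maximum independent sets.

  module Accumulate (a : ℕ) (a-max : ∀ S → MaximumIndependent G S → a ≤ ∣ S ∣) (k b β : ℕ)
    (2kβ≤a : 2 * (k * β) ≤ a) (2n<[1+k]a : n + n < suc k * a)
    (local : ∀ {γ} → MaximumIndependent G γ → Σ (Subset n) λ T → ∣ T ∣ ≤ b ×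
      (∀ S → MaximumIndependent G S → Missed T S → count (λ i → (i ∈? S) ×-dec (i ∈? γ)) ≤ β)) where

    -- After `r` rounds, `U` is the union of the sets used as `γ` and `T` that of their local
    -- hitting sets.
    record State (r : ℕ) : Set where
      field
        U T     : Subset n
        U-large : r * a ≤ ∣ U ∣ + ∣ U ∣
        T-small : ∣ T ∣ ≤ r * b
        meets   : ∀ S → MaximumIndependent G S → Missed T S → count (λ i → (i ∈? S) ×-dec (i ∈? U)) ≤ r * β

    initial : State 0
    initial = record
      { U = subset none? ; T = subset none? ; U-large = z≤n
      ; T-small = ≤-reflexive (trans (∣subset∣ none?) (count-none none? (λ _ → id)))
      ; meets = λ S _ _ → ≤-reflexive (count-none (λ i → (i ∈? S) ×-dec (i ∈? subset none?))
                  (λ i (_ , m) → ∈-subset⁻ none? i m)) }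
      where
      none? : (i : Fin n) → Dec ⊥
      none? _ = no id

    step : ∀ {r} → r ≤ k → (st : State r) → ∀ S → MaximumIndependent G S → Missed (State.T st) S → State (suc r)
    step {r} r≤k st S S-max missed = record
      { U = U ∪ S ; T = T ∪ T′ ; U-large = U∪S-large
      ; T-small = ≤-trans (union-≤ T T′) (≤-trans (+-mono-≤ T-small T′-small) (≤-reflexive (+-comm (r * b) b)))
      ; meets = λ S′ S′-max missed′ → ≤-trans
          (count-cover (λ i → (i ∈? S′) ×-dec (i ∈? (U ∪ S)))
                       (λ i → (i ∈? S′) ×-dec (i ∈? U)) (λ i → (i ∈? S′) ×-dec (i ∈? S))
            (λ i (m , u) → [ (λ x → inj₁ (m , x)) , (λ x → inj₂ (m , x)) ]′ (x∈p∪q⁻ U S u)))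
          (≤-trans (+-mono-≤ (meets S′ S′-max (λ i m t → missed′ i m (x∈p∪q⁺ (inj₁ t))))
                             (T′-meets S′ S′-max (λ i m t → missed′ i m (x∈p∪q⁺ (inj₂ t)))))
                   (≤-reflexive (+-comm (r * β) β))) }
      where
      open State st
      T′ = proj₁ (local S-max)
      T′-small = proj₁ (proj₂ (local S-max))
      T′-meets = proj₂ (proj₂ (local S-max))
      union-≤ : ∀ P Q → ∣ P ∪ Q ∣ ≤ ∣ P ∣ + ∣ Q ∣
      union-≤ P Q = subst₂ _≤_ (sym ∣ P ∪ Q ∣≡count) (cong₂ _+_ (sym ∣ P ∣≡count) (sym ∣ Q ∣≡count))
        (count-cover (_∈? (P ∪ Q)) (_∈? P) (_∈? Q) (λ _ → x∈p∪q⁻ P Q))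
      old? = λ i → (i ∈? S) ×-dec (i ∈? U)
      new? = λ i → (i ∈? S) ×-dec ¬? (i ∈? U)
      new = count new?
      a≤new+rβ : a ≤ new + r * β
      a≤new+rβ = ≤-trans (a-max S S-max) (≤-trans (≤-reflexive ∣ S ∣≡count)
        (≤-trans (count-cover (_∈? S) new? old? split) (+-monoʳ-≤ new (meets S S-max missed))))
        where
        split : ∀ i → i ∈ S → (i ∈ S × ¬ i ∈ U) ⊎ (i ∈ S × i ∈ U)
        split i m with i ∈? U
        ... | yes u = inj₂ (m , u)
        ... | no ¬u = inj₁ (m , ¬u)
      a≤2new : a ≤ new + new
      -- `S` misses `T`, so at most `r * β` of its chords are old; this is at most half of `a`.
      a≤2new = +-cancelʳ-≤ a a (new + new) (begin
        a + a                         ≤⟨ +-mono-≤ a≤new+rβ a≤new+rβ ⟩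
        new + r * β + (new + r * β)   ≡⟨ interchange new (r * β) new (r * β) ⟩
        new + new + (r * β + r * β)   ≤⟨ +-monoʳ-≤ (new + new) (+-mono-≤ (*-monoˡ-≤ β r≤k) (*-monoˡ-≤ β r≤k)) ⟩
        new + new + (k * β + k * β)   ≡⟨ cong (λ z → new + new + (k * β + z)) (sym (+-identityʳ (k * β))) ⟩
        new + new + 2 * (k * β)       ≤⟨ +-monoʳ-≤ (new + new) 2kβ≤a ⟩
        new + new + a                 ∎)
        where
        open ≤-Reasoning
      U+new≤ : ∣ U ∣ + new ≤ ∣ U ∪ S ∣
      U+new≤ = subst₂ _≤_ (cong (_+ new) (sym ∣ U ∣≡count)) (sym ∣ U ∪ S ∣≡count)
        (count-disjoint (_∈? (U ∪ S)) (_∈? U) new? (λ _ u → x∈p∪q⁺ (inj₁ u)) (λ _ (m , _) → x∈p∪q⁺ (inj₂ m))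
          (λ _ u (_ , ¬u) → ¬u u))
      U∪S-large : suc r * a ≤ ∣ U ∪ S ∣ + ∣ U ∪ S ∣
      U∪S-large = begin
        a + r * a                       ≤⟨ +-mono-≤ a≤2new U-large ⟩
        new + new + (∣ U ∣ + ∣ U ∣)     ≡⟨ +-comm (new + new) _ ⟩
        ∣ U ∣ + ∣ U ∣ + (new + new)     ≡⟨ interchange (∣ U ∣) (∣ U ∣) new new ⟩
        ∣ U ∣ + new + (∣ U ∣ + new)     ≤⟨ +-mono-≤ U+new≤ U+new≤ ⟩
        ∣ U ∪ S ∣ + ∣ U ∪ S ∣           ∎
        where
        open ≤-Reasoning

    search : ∀ fuel r → fuel + r ≡ k → State r → Σ (Subset n) λ T → HittingSet G T × ∣ T ∣ ≤ k * b
    search fuel r e st with hitting-or-missed (State.T st)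
    ... | inj₁ hits = State.T st , hits ,
      ≤-trans (State.T-small st) (*-monoˡ-≤ b (≤-trans (m≤n+m r fuel) (≤-reflexive e)))
    -- A further round would give `suc k * a` ≤ 2∣`U`∣ ≤ 2`n`.
    search zero r refl st | inj₂ (S , S-max , missed) = ⊥-elim (<⇒≱ 2n<[1+k]a
      (≤-trans (State.U-large next) (+-mono-≤ (∣p∣≤n (State.U next)) (∣p∣≤n (State.U next)))))
      where
      next = step ≤-refl st S S-max missed
    search (suc fuel) r e st | inj₂ (S , S-max , missed) =
      search fuel (suc r) (trans (+-suc fuel r) e)
        (step (≤-trans (m≤n+m r (suc fuel)) (≤-reflexive e)) st S S-max missed)

    hitting-set : Σ (Subset n) λ T → HittingSet G T × ∣ T ∣ ≤ k * b
    hitting-set = search k 0 (+-identityʳ k) initial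

-- Choice of the parameters.

scaled-root : ∀ κ .{{_ : NonZero κ}} n → ∃ λ e → κ * e * (κ * e) ≤ n × n < κ * suc e * (κ * suc e)
scaled-root κ zero = 0 , ≤-reflexive (cong (λ z → z * z) (*-zeroʳ κ)) ,
  *-mono-< {0} {κ * 1} {0} {κ * 1} 0<κ*1 0<κ*1
  where
  0<κ*1 : 0 < κ * 1
  0<κ*1 = ≤-trans (>-nonZero⁻¹ κ) (≤-reflexive (sym (*-identityʳ κ)))
scaled-root κ (suc n) with scaled-root κ n
... | e , lower , upper with κ * suc e * (κ * suc e) ≤? suc n
...   | no ¬next = e , m≤n⇒m≤1+n lower , ≰⇒> ¬next
-- Raising `n` by one raises the root by at most one.
...   | yes next = suc e , next , ≤-<-trans upper (*-mono-< grow grow)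
  where
  grow : κ * suc e < κ * suc (suc e)
  grow = *-monoʳ-< κ ≤-refl

-- With κ = 4q, w = e ≈ √n / κ and b = 4κ²e ≥ n / w, a set of size 2q · b is found, which is
-- hitting-constant q * e.
hitting-constant : ℕ → ℕ
hitting-constant q = 4 * q * (4 * q * (8 * q))

-- The degree threshold `k * b` equals the size allowed in the end: a closed neighbourhood within it
-- already suffices, and otherwise it bounds the number of arcs.
bounded-hitting-set : ∀ {n} → 0 < n → (G : CircleGraph n) → ∀ a → (∀ S → MaximumIndependent G S → a ≤ ∣ S ∣) →
  ∀ k b β w .{{_ : NonZero w}} → 2 * (k * β) ≤ a → n + n < suc k * a → n ≤ w * b →
  (∀ m → m * (k * b) ≤ n + n → suc m * w + suc m * w ≤ β) →
  Σ (Subset n) λ T → HittingSet G T × ∣ T ∣ ≤ k * b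
bounded-hitting-set {n} 0<n G a a-max k b β w 2kβ≤a 2n<[1+k]a n≤wb β-large =
  by-degree (any? (λ v → count (closed? G v) ≤? k * b))
  where
  from-arcs : (∃ λ m → m * (k * b) ≤ n + n × (∀ {γ} → MaximumIndependent G γ → ∀ w .{{_ : NonZero w}} →
      Σ (Subset n) λ T → w * ∣ T ∣ ≤ n × (∀ S → MaximumIndependent G S → Missed G T S →
        count (λ i → (i ∈? S) ×-dec (i ∈? γ)) ≤ suc m * w + suc m * w))) →
    Σ (Subset n) λ T → HittingSet G T × ∣ T ∣ ≤ k * b
  from-arcs (m , mD≤2n , local) = Accumulate.hitting-set G a a-max k b β 2kβ≤a 2n<[1+k]a local′
    where
    local′ : ∀ {γ} → MaximumIndependent G γ → Σ (Subset n) λ T → ∣ T ∣ ≤ b ×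
      (∀ S → MaximumIndependent G S → Missed G T S → count (λ i → (i ∈? S) ×-dec (i ∈? γ)) ≤ β)
    local′ γ-max with local γ-max w
    ... | T , w∣T∣≤n , T-meets = T , *-cancelˡ-≤ w (≤-trans w∣T∣≤n n≤wb) ,
      λ S S-max missed → ≤-trans (T-meets S S-max missed) (β-large m mD≤2n)

  by-degree : Dec (∃ λ v → count (closed? G v) ≤ k * b) → Σ (Subset n) λ T → HittingSet G T × ∣ T ∣ ≤ k * b
  by-degree (yes (v , #≤)) =
    subset (closed? G v) , neighbourhood-hits G v , ≤-trans (≤-reflexive (∣subset∣ (closed? G v))) #≤
  by-degree (no ¬small) =
    from-arcs (small-intersections G 0<n (k * b) (λ v → <⇒≤ (≰⇒> (λ #≤ → ¬small (v , #≤)))))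

module Budget (q : ℕ) .{{_ : NonZero q}} (n a : ℕ) (0<a : 0 < a) (n≤qa : n ≤ q * a)
  (e : ℕ) .{{_ : NonZero e}} (κe²≤n : 4 * q * e * (4 * q * e) ≤ n)
  (n< : n < 4 * q * suc e * (4 * q * suc e)) where

  open ≤-Reasoning
  open +-*-Solver

  κ C k B β : ℕ
  κ = 4 * q
  C = hitting-constant q
  k = 2 * q
  B = 4 * (κ * κ) * e
  β = (e + e) * e + (e + e) * e

  instance
    κ≢0 : NonZero κ
    κ≢0 = m*n≢0 4 q
    k≢0 : NonZero k
    k≢0 = m*n≢0 2 q
    B≢0 : NonZero B
    B≢0 = m*n≢0 (4 * (κ * κ)) e {{m*n≢0 4 (κ * κ) {{_}} {{m*n≢0 κ κ}}}}
    kB≢0 : NonZero (k * B)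
    kB≢0 = m*n≢0 k B

  kB≡Ce : k * B ≡ C * e
  kB≡Ce = solve 3 (λ q κ e → con 2 :* q :* (con 4 :* (κ :* κ) :* e) := κ :* (κ :* (con 8 :* q)) :* e) refl q κ e

  within-budget : ∀ t → t ≤ k * B → t * t ≤ C * C * n
  within-budget t t≤ = begin
    t * t              ≤⟨ *-mono-≤ t≤ t≤ ⟩
    k * B * (k * B)    ≡⟨ cong₂ _*_ kB≡Ce kB≡Ce ⟩
    C * e * (C * e)    ≡⟨ [m*n]*[o*p]≡[m*o]*[n*p] C e C e ⟩
    C * C * (e * e)    ≤⟨ *-monoʳ-≤ (C * C) (≤-trans (*-mono-≤ (m≤n*m e κ) (m≤n*m e κ)) κe²≤n) ⟩
    C * C * n          ∎

  1+e≤2e : suc e ≤ e + e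
  1+e≤2e = +-monoˡ-≤ e (>-nonZero⁻¹ e)

  n≤eB : n ≤ e * B
  n≤eB = begin
    n                              ≤⟨ <⇒≤ n< ⟩
    κ * suc e * (κ * suc e)        ≤⟨ *-mono-≤ (*-monoʳ-≤ κ 1+e≤2e) (*-monoʳ-≤ κ 1+e≤2e) ⟩
    κ * (e + e) * (κ * (e + e))    ≡⟨ solve 2 (λ κ e →
        κ :* (e :+ e) :* (κ :* (e :+ e)) := e :* (con 4 :* (κ :* κ) :* e)) refl κ e ⟩
    e * B                          ∎

  -- Here 2`n` ≤ 2`e * B`, and 2 ≤ `k` absorbs the factor.
  m≤e : ∀ m → m * (k * B) ≤ n + n → m ≤ e
  m≤e m h = *-cancelʳ-≤ m e (k * B) (begin
    m * (k * B)      ≤⟨ h ⟩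
    n + n            ≤⟨ +-mono-≤ n≤eB n≤eB ⟩
    e * B + e * B    ≡⟨ solve 2 (λ e B → e :* B :+ e :* B := e :* (con 2 :* B)) refl e B ⟩
    e * (2 * B)      ≤⟨ *-monoʳ-≤ e (*-monoˡ-≤ B (m≤m*n 2 q)) ⟩
    e * (k * B)      ∎)

  2kβ≤a : 2 * (k * β) ≤ a
  2kβ≤a = *-cancelˡ-≤ q (begin
    -- The factor 4 in `κ` is what makes this expression exactly the square of `κ * e`.
    q * (2 * (k * β))    ≡⟨ solve 2 (λ q e →
        q :* (con 2 :* (con 2 :* q :* ((e :+ e) :* e :+ (e :+ e) :* e))) := con 4 :* q :* e :* (con 4 :* q :* e)) refl q e ⟩
    κ * e * (κ * e)      ≤⟨ κe²≤n ⟩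
    n                    ≤⟨ n≤qa ⟩
    q * a                ∎)

  2n<[1+k]a : n + n < suc k * a
  2n<[1+k]a = begin-strict
    n + n            ≤⟨ +-mono-≤ n≤qa n≤qa ⟩
    q * a + q * a    ≡⟨ solve 2 (λ q a → q :* a :+ q :* a := con 2 :* q :* a) refl q a ⟩
    k * a            <⟨ +-monoˡ-< (k * a) 0<a ⟩
    suc k * a        ∎

  2[1+m]e≤β : ∀ m → m * (k * B) ≤ n + n → suc m * e + suc m * e ≤ β
  2[1+m]e≤β m mD≤2n = +-mono-≤ (*-monoˡ-≤ e 1+m≤2e) (*-monoˡ-≤ e 1+m≤2e)
    where
    1+m≤2e : suc m ≤ e + e
    1+m≤2e = ≤-trans (s≤s (m≤e m mD≤2n)) 1+e≤2e

linear-independence⇒hitting : ∀ q .{{_ : NonZero q}} n → 0 < n → (G : CircleGraph n) → ∀ a →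
  IndependenceNumber G a → n ≤ q * a →
  Σ (Subset n) λ T → HittingSet G T × ∣ T ∣ * ∣ T ∣ ≤ hitting-constant q * hitting-constant q * n
linear-independence⇒hitting q n 0<n G a (S₀ , (S₀-ind , S₀-max) , ∣S₀∣≡a) n≤qa =
  by-root (scaled-root (4 * q) {{m*n≢0 4 q}} n)
  where
  C = hitting-constant q

  a-max : ∀ S → MaximumIndependent G S → a ≤ ∣ S ∣
  a-max S (_ , S-max) = subst (_≤ ∣ S ∣) ∣S₀∣≡a (S-max S₀ S₀-ind)

  0<a : 0 < a
  0<a = n≢0⇒n>0 λ a≡0 →
    <⇒≱ 0<n (≤-trans n≤qa (≤-reflexive (trans (cong (q *_) a≡0) (*-zeroʳ q))))

  by-root : (∃ λ e → 4 * q * e * (4 * q * e) ≤ n × n < 4 * q * suc e * (4 * q * suc e)) →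
            Σ (Subset n) λ T → HittingSet G T × ∣ T ∣ * ∣ T ∣ ≤ C * C * n
  -- A zero root means that `n` is less than the square of `κ`, so the whole vertex set is small
  -- enough.
  by-root (zero , _ , n<) = ⊤ , hits , (begin
    ∣ ⊤ {n} ∣ * ∣ ⊤ {n} ∣  ≡⟨ cong₂ _*_ (∣⊤∣≡n n) (∣⊤∣≡n n) ⟩
    n * n                  ≤⟨ *-monoˡ-≤ n (≤-trans (<⇒≤ n<) (*-mono-≤ κ≤C κ≤C)) ⟩
    C * C * n              ∎)
    where
    open ≤-Reasoning
    κ≤C : 4 * q * 1 ≤ C
    κ≤C = *-monoʳ-≤ (4 * q) (>-nonZero⁻¹ (4 * q * (8 * q)) {{m*n≢0 (4 * q) (8 * q) {{m*n≢0 4 q}} {{m*n≢0 8 q}}}})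
    hits : HittingSet G ⊤
    hits S S-max with nonempty? S
    ... | yes (i , i∈S) = i , x∈p∩q⁺ (∈⊤ , i∈S)
    ... | no ¬ne = ⊥-elim (<⇒≱ 0<a (≤-trans (a-max S S-max) (≤-reflexive
            (trans ∣ S ∣≡count (count-none (_∈? S) (λ i m → ¬ne (i , m)))))))
  by-root (suc e , κe²≤n , n<) = T , T-hits , within-budget ∣ T ∣ ∣T∣≤kB
    where
    open Budget q n a 0<a n≤qa (suc e) κe²≤n n<
    bounded = bounded-hitting-set 0<n G a a-max k B β (suc e) 2kβ≤a 2n<[1+k]a n≤eB 2[1+m]e≤β
    T = proj₁ bounded
    T-hits = proj₁ (proj₂ bounded)
    ∣T∣≤kB = proj₂ (proj₂ bounded)

-- Clearing denominators gives `a * suc q-1` = `suc p * n`, and the numerator is at least one.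
-- Unnormalised rationals yield this cross-multiplied equation without gcds.
proportion-bound : ∀ p q-1 .(cop : Coprime (suc p) (suc q-1)) a n →
  (+ a Rat./ 1) ≡ mkℚ +[1+ p ] q-1 cop Rat.* (+ n Rat./ 1) → n ≤ suc q-1 * a
proportion-bound p q-1 cop a n e = begin
  n              ≤⟨ m≤n*m n (suc p) ⟩
  suc p * n      ≡⟨ ℤₚ.+-injective (trans (ℤₚ.pos-* (suc p) n) (trans (sym (ℤₚ.*-identityʳ _)) (trans (sym cross)
                     (trans (cong (λ z → + a ℤ.* + z) (*-identityʳ (suc q-1))) (sym (ℤₚ.pos-* a (suc q-1))))))) ⟩
  a * suc q-1    ≡⟨ *-comm a (suc q-1) ⟩
  suc q-1 * a    ∎
  where
  open ≤-Reasoning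
  c = mkℚ +[1+ p ] q-1 cop
  integer : ∀ b → Rat.toℚᵘ (+ b Rat./ 1) ℚᵘ.≃ ℚᵘ.mkℚᵘ (+ b) 0
  integer b = ℚₚ.toℚᵘ-fromℚᵘ (ℚᵘ.mkℚᵘ (+ b) 0)
  unnormalised : ℚᵘ.mkℚᵘ (+ a) 0 ℚᵘ.≃ ℚᵘ.mkℚᵘ +[1+ p ] q-1 ℚᵘ.* ℚᵘ.mkℚᵘ (+ n) 0
  unnormalised = ℚᵘₚ.≃-trans (ℚᵘₚ.≃-sym (integer a))
    (ℚᵘₚ.≃-trans (ℚₚ.toℚᵘ-cong e)
      (ℚᵘₚ.≃-trans (ℚₚ.toℚᵘ-homo-* c (+ n Rat./ 1)) (ℚᵘₚ.*-congˡ {Rat.toℚᵘ c} (integer n))))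
  cross : + a ℤ.* + (suc q-1 * 1) ≡ (+[1+ p ] ℤ.* + n) ℤ.* + 1
  cross with unnormalised
  ... | ℚᵘ.*≡* eq = eq

theorem1p6 : (c : ℚ) → 0ℚ Data.Rational.< c →
    Σ ℕ λ C → ∀ (n : ℕ) → 0 < n → (G : CircleGraph n) → (a : ℕ) →
    IndependenceNumber G a → (+ a / 1) ≡ c Data.Rational.* (+ n / 1) →
    Σ (Subset n) λ T → HittingSet G T × ∣ T ∣ * ∣ T ∣ ≤ C * C * n
theorem1p6 (mkℚ (+ 0)    q-1 cop) (Rat.*<* (ℤ.+<+ ()))
theorem1p6 (mkℚ -[1+ _ ] q-1 cop) (Rat.*<* ())
-- A positive rational is at least the reciprocal of its denominator, so the constant is taken from
-- the denominator alone.
theorem1p6 (mkℚ +[1+ p ] q-1 cop) _ = hitting-constant (suc q-1) , λ n 0<n G a α e →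
  linear-independence⇒hitting (suc q-1) n 0<n G a α (proportion-bound p q-1 cop a n e)
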